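{- The ordinary generating function of the sequence $\delta_P(n)$, $n\ge 1$, is $$\sum_{n\ge 1}\delta_P(n)z^n=\frac{z}{1-z}\left(2\prod_{k\ge 1}\left(1+z^{2^k-1}\right)-\frac{1}{1-z}\right)$$ (as an identity of formal power series).
   Context: $\mathcal{T}_\infty$ is the infinite binary tree with all leaves at the same level: its vertices are the pairs $(i,j)$ of integers with $i\ge 1$, $j\ge 0$; the vertex $(i,j)$ has parent $(i+1,\lfloor j/2\rfloor)$, and the edges join each vertex to its parent. For a finite vertex set $S$, $\overline S$ is its complement and $(S,\overline S)$ is the set of edges with one end in $S$ and the other in $\overline S$. $\delta_P(n)$ is the minimum of $|(S,\overline S)|$ over all $S\subset V(\mathcal{T}_\infty)$ with $|S|=n$ such that $\overline S$ induces a connected subgraph. -}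

module Defs where

open import Data.Fin.Base using (toℕ)
open import Data.Integer.Base using (ℤ; +_; 0ℤ; 1ℤ; -1ℤ)
import Data.Integer.Base as ℤ
import Data.Integer.Properties as ℤ
open import Data.List.Base using (length)
import Data.List.Membership.Propositional as List
open import Data.List.Relation.Unary.Unique.Propositional using (Unique)
open import Data.Nat.Base
  using (ℕ; zero; suc; _∸_; _^_; _≤_; _⊔_; ⌊_/2⌋; NonZero)
open import Data.Nat.Properties using (_≟_; ≤-antisym; m≤m⊔n; m≤n⊔m)
open import Data.Product using (∃-syntax; _×_; _,_)
open import Data.Sum.Base using (_⊎_)
open import Data.Bool.Base using (if_then_else_)
open import Function.Bundles using (_⇔_)
open import Level using (0ℓ)
open import Relation.Binary.Core using (Rel)
open import Relation.Binary.Construct.Closure.ReflexiveTransitive using (Star)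
open import Relation.Binary.PropositionalEquality
  using (_≡_; refl; sym; trans; cong)
open import Relation.Nullary.Decidable using (does)
open import Relation.Unary using (Pred; _∈_; _∉_; ∁)

open import Algebra.Properties.Semiring.Sum ℤ.+-*-semiring
  using (sum⁺-syntax; sum-replicate-zero)

record Vertex : Set where
  constructor ⟨_,_⟩
  field
    level          : ℕ
    index          : ℕ
    .{{level≥1}}   : NonZero level

open Vertex public

-- The parent of (i , j) is one level higher, so the leaves form level 1.
parent : Vertex → Vertex
parent v = ⟨ suc (level v) , ⌊ index v /2⌋ ⟩

Adj : Rel Vertex 0ℓ
Adj u v = (v ≡ parent u) ⊎ (u ≡ parent v)

Connected : Pred Vertex 0ℓ → Set
Connected U = ∀ u v → u ∈ U → v ∈ U →
  Star (λ x y → Adj x y × x ∈ U × y ∈ U) u v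

HasSize : {A : Set} → Pred A 0ℓ → ℕ → Set
HasSize P n = ∃[ xs ] (Unique xs × length xs ≡ n × (∀ x → (x List.∈ xs) ⇔ (x ∈ P)))

-- An edge with one end in S and the other in ∁ S is recorded exactly once,
-- as the ordered pair (end in S , end in ∁ S).
Cut : Pred Vertex 0ℓ → Pred (Vertex × Vertex) 0ℓ
Cut S (u , v) = Adj u v × u ∈ S × v ∉ S

Admissible : ℕ → Pred Vertex 0ℓ → Set
Admissible n S = HasSize S n × Connected (∁ S)

-- d = δ_P(n)
IsδP : ℕ → ℕ → Set₁
IsδP n d =
  (∃[ S ] (Admissible n S × HasSize (Cut S) d)) ×
  (∀ S k → Admissible n S → HasSize (Cut S) k → d ≤ k)

IsδP-unique : ∀ {n d e} → IsδP n d → IsδP n e → d ≡ e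
IsδP-unique ((S , aS , cS) , minS) ((T , aT , cT) , minT) =
  ≤-antisym (minS T _ aT cT) (minT S _ aS cS)

Series : Set
Series = ℕ → ℤ

infix  4 _≈_
infixl 6 _⊕_ _⊖_
infixl 7 _⊛_ _•_

_≈_ : Rel Series 0ℓ
f ≈ g = ∀ n → f n ≡ g n

_⊕_ _⊖_ _⊛_ : Series → Series → Series
(f ⊕ g) n = f n ℤ.+ g n
(f ⊖ g) n = f n ℤ.- g n
(f ⊛ g) n = ∑[ i ≤ n ] (f (toℕ i) ℤ.* g (n ∸ toℕ i))

_•_ : ℤ → Series → Series
(c • f) n = c ℤ.* f n

z^_ : ℕ → Series
(z^ m) n = if does (m ≟ n) then 1ℤ else 0ℤ

z 𝟙 : Series
z = z^ 1
𝟙 = z^ 0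

1/[1-z] : Series
1/[1-z] _ = 1ℤ

1/[1-z]-inverse : (𝟙 ⊖ z) ⊛ 1/[1-z] ≈ 𝟙
1/[1-z]-inverse zero          = refl
1/[1-z]-inverse (suc zero)    = refl
1/[1-z]-inverse (suc (suc n)) =
  cong (λ s → 1ℤ ℤ.+ (-1ℤ ℤ.+ s)) (sum-replicate-zero (suc n))

-- ∏_{k=1}^{m} f k
partialProduct : (ℕ → Series) → ℕ → Series
partialProduct f zero    = 𝟙
partialProduct f (suc m) = partialProduct f m ⊛ f (suc m)

-- g = ∏_{k≥1} f k: each coefficient of the partial products is eventually
-- constant, equal to that of g.
IsInfiniteProduct : (ℕ → Series) → Series → Set
IsInfiniteProduct f g =
  ∀ n → ∃[ N ] (∀ m → N ≤ m → partialProduct f m n ≡ g n)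

IsInfiniteProduct-unique : ∀ {f g h} →
  IsInfiniteProduct f g → IsInfiniteProduct f h → g ≈ h
IsInfiniteProduct-unique pg ph n with pg n | ph n
... | M , eg | N , eh =
  trans (sym (eg (M ⊔ N) (m≤m⊔n M N))) (eh (M ⊔ N) (m≤n⊔m M N))

-- ∑_{n≥1} a(n) zⁿ; the value a 0 is ignored.
ogf : (ℕ → ℕ) → Series
ogf a zero    = 0ℤ
ogf a (suc n) = + a (suc n)

factor : ℕ → Series
factor k = 𝟙 ⊕ z^ (2 ^ k ∸ 1)

{-# OPTIONS --safe #-}
-- The complement of a finite S is connected iff S contains the children of its
-- elements, that is, iff S is a disjoint union of complete binary subtrees; the
-- cut then has one edge per subtree, so δ_P(n) is the least number of summands
-- 2^k - 1, k ≥ 1, with sum n.  Skew binary numerals attain this minimum.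
-- Passing from n to n + 1 adds a summand 1 if the numeral of n has no digit 2,
-- and otherwise merges two equal summands with the new unit.  Since the numbers
-- with no digit 2 are exactly the sums of distinct 2^k - 1, and in only one
-- way, δ_P(n + 1) - δ_P(n) = 2 [zⁿ] ∏ (1 + z^(2^k - 1)) - 1.
module Submission where

open import Defs
open import Data.Bool.Base using (Bool; true; false; if_then_else_)
open import Data.Fin.Base using (toℕ)
open import Data.Integer.Base using (ℤ; 0ℤ; 1ℤ)
import Data.Integer.Base as ℤ
import Data.Integer.Properties as ℤ
open import Algebra.Properties.Semiring.Sum ℤ.+-*-semiring
  using (∑-distrib-+; sum-cong-≗; sum-replicate-zero)
open import Data.List.Base using (List; []; _∷_; _++_; length; map; concatMap)
open import Data.List.Extrema.Nat using (max; xs≤max)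
open import Data.List.Membership.Propositional using (find; lose) renaming (_∈_ to _∈ᴸ_)
open import Data.List.Membership.Propositional.Properties
  using (∈-++⁺ˡ; ∈-++⁺ʳ; ∈-++⁻; ∈-map⁺; ∈-map⁻; ∈-concatMap⁺; ∈-concatMap⁻)
open import Data.List.Membership.Propositional.Properties.WithK using (unique∧set⇒bag)
open import Data.List.Properties using (length-++; length-map)
open import Data.List.Relation.Binary.BagAndSetEquality using (∼bag⇒↭)
open import Data.List.Relation.Binary.Disjoint.Propositional using (Disjoint)
open import Data.List.Relation.Binary.Permutation.Propositional.Properties using (↭-length)
open import Data.List.Relation.Unary.All as All using ([]; _∷_)
import Data.List.Relation.Unary.All.Properties as All
open import Data.List.Relation.Unary.AllPairs using (AllPairs; []; _∷_)
import Data.List.Relation.Unary.AllPairs.Properties as AllPairs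
open import Data.List.Relation.Unary.Any as Any using (Any; here; there)
open import Data.List.Relation.Unary.Unique.Propositional using (Unique)
import Data.List.Relation.Unary.Unique.Propositional.Properties as Unique
open import Data.Nat.Base
open import Data.Nat.Properties
open import Data.Nat.Tactic.RingSolver using (solve-∀)
open import Data.Product using (∃-syntax; _×_; _,_; proj₁; proj₂)
open import Data.Sum.Base using (_⊎_; inj₁; inj₂; swap)
open import Function.Base using (_∘_; case_of_)
open import Function.Bundles using (_⇔_; mk⇔; Equivalence)
open import Level using (0ℓ)
open import Relation.Binary.Construct.Closure.ReflexiveTransitive
  using (Star; ε; _◅_; _◅◅_; reverse)
open import Relation.Binary.Core using (Rel)
open import Relation.Binary.Definitions using (DecidableEquality)
open import Relation.Binary.PropositionalEquality
open import Relation.Nullary.Decidable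
  using (yes; no; dec-true; dec-false; map′; _×-dec_; decidable-stable)
open import Relation.Nullary.Negation using (¬_; contradiction)
open import Relation.Unary using (Pred; _∈_; _∉_; ∁)

-- Skew binary numerals

treeSize : ℕ → ℕ
treeSize k = 2 ^ k ∸ 1

suc-treeSize : ∀ k → suc (treeSize k) ≡ 2 ^ k
suc-treeSize k = m+[n∸m]≡n (m^n>0 2 k)

double : ∀ n → 2 * n ≡ n + n
double n = cong (n +_) (+-identityʳ n)

treeSize-suc : ∀ k → treeSize (suc k) ≡ suc (treeSize k + treeSize k)
treeSize-suc k = begin
  2 * 2 ^ k ∸ 1                            ≡⟨ cong (_∸ 1) (double (2 ^ k)) ⟩
  2 ^ k + 2 ^ k ∸ 1                        ≡⟨ cong (λ x → x + x ∸ 1) (suc-treeSize k) ⟨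
  treeSize k + suc (treeSize k)            ≡⟨ +-suc (treeSize k) (treeSize k) ⟩
  suc (treeSize k + treeSize k)            ∎
  where open ≡-Reasoning

treeSize+treeSize< : ∀ k → treeSize k + treeSize k < treeSize (suc k)
treeSize+treeSize< k = ≤-reflexive (sym (treeSize-suc k))

treeSize-mono : ∀ k → treeSize k ≤ treeSize (suc k)
treeSize-mono k = ≤-trans (m≤m+n _ _) (<⇒≤ (treeSize+treeSize< k))

-- A list of numbers l stands for a forest of complete trees of heights l + 1.
total : List ℕ → ℕ
total []       = 0
total (l ∷ ls) = treeSize (suc l) + total ls

total-[_] : ∀ {n} l → n ≡ treeSize l + treeSize l → total (l ∷ []) ≡ suc n
total-[ l ] eq = trans (+-identityʳ _) (trans (treeSize-suc l) (cong suc (sym eq)))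

weight : List ℕ → ℕ
weight []       = 0
weight (l ∷ ls) = 2 ^ suc l + weight ls

-- A tree size is one short of a power of 2, so adding the number of summands turns a sum of tree
-- sizes into a sum of powers of 2, to which counts of binary digits apply.
total+length : ∀ ls → total ls + length ls ≡ weight ls
total+length []       = refl
total+length (l ∷ ls) = begin
  treeSize (suc l) + total ls + suc (length ls)
    ≡⟨ rearrange (treeSize (suc l)) (total ls) (length ls) ⟩
  suc (treeSize (suc l)) + (total ls + length ls)
    ≡⟨ cong₂ _+_ (suc-treeSize (suc l)) (total+length ls) ⟩
  2 ^ suc l + weight ls ∎
  where
  open ≡-Reasoning
  rearrange : ∀ a b c → a + b + suc c ≡ suc a + (b + c)
  rearrange = solve-∀

-- Skew binary numerals of the numbers below 2^(m+1) - 1: the digit of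
-- 2^k - 1 is 0 or 1, except that the lowest nonzero digit may be 2.
-- The Boolean tells whether no digit is 2.
data Skew : ℕ → List ℕ → Bool → Set where
  nil   : Skew 0 [] true
  skip  : ∀ {m ls b} → Skew m ls b → Skew (suc m) ls b
  once  : ∀ {m ls b} → Skew m ls b → Skew (suc m) (m ∷ ls) b
  twice : ∀ {m} → Skew (suc m) (m ∷ m ∷ []) false

-- How adding 1 changes the number of summands: `grow` if no digit is 2, `shrink` if two equal
-- summands merge with the unit into one.
data Step : Bool → ℕ → ℕ → Set where
  grow   : ∀ {w} → Step true w (suc w)
  shrink : ∀ {w} → Step false (suc w) w

Step-suc : ∀ {b v w} → Step b v w → Step b (suc v) (suc w)
Step-suc grow   = grow
Step-suc shrink = shrink

Next : ℕ → List ℕ → Bool → Set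
Next m ls b = ∃[ ls′ ] ∃[ b′ ]
  (Skew m ls′ b′ × total ls′ ≡ suc (total ls) × Step b (length ls) (length ls′))

-- The largest numeral within the bound `m`. Its successor has the total `treeSize (suc m)`, a
-- single summand beyond the bound, whence the length 1.
Full : ℕ → List ℕ → Bool → Set
Full m ls b = total ls ≡ treeSize m + treeSize m × Step b (length ls) 1

Skew-[] : ∀ m → Skew m [] true
Skew-[] zero    = nil
Skew-[] (suc m) = skip (Skew-[] m)

increment : ∀ {m ls b} → Skew m ls b → Next m ls b ⊎ Full m ls b
increment nil = inj₂ (refl , grow)
increment (skip {m} s) with increment s
... | inj₁ (ls′ , b′ , s′ , eq , st) = inj₁ (ls′ , b′ , skip s′ , eq , st)
... | inj₂ (eq , st) = inj₁ (m ∷ [] , true , once (Skew-[] m) , total-[ m ] eq , st)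
increment (once {m} s) with increment s
... | inj₁ (ls′ , b′ , s′ , eq , st) = inj₁ (m ∷ ls′ , b′ , once s′ ,
  trans (cong (treeSize (suc m) +_) eq) (+-suc (treeSize (suc m)) _) , Step-suc st)
-- The lower digits overflow: the digit 1 becomes 2 and all lower digits become 0.
... | inj₂ (eq , st) = inj₁ (m ∷ m ∷ [] , false , twice ,
  trans (cong (treeSize (suc m) +_) (total-[ m ] eq)) (+-suc (treeSize (suc m)) _) , Step-suc st)
increment (twice {m}) = inj₂ (cong (treeSize (suc m) +_) (+-identityʳ _) , shrink)

incrementUnbounded : ∀ {m ls b} → Skew m ls b → ∃[ m′ ] Next m′ ls b
incrementUnbounded {m} s with increment s
... | inj₁ next      = m , next
... | inj₂ (eq , st) = suc m , m ∷ [] , true , once (Skew-[] m) , total-[ m ] eq , st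

-- Attained by `twice`. After subtracting 1 the bound is strict, so that 2^(m+1) can be added
-- without a carry.
Skew-weight : ∀ {m ls b} → Skew m ls b → weight ls ≤ 2 ^ suc m
Skew-weight nil = z≤n
Skew-weight (skip s) = ≤-trans (Skew-weight s) (m≤m+n _ _)
Skew-weight (once {m} {ls} s) = begin
  2 ^ suc m + weight ls     ≤⟨ +-monoʳ-≤ (2 ^ suc m) (Skew-weight s) ⟩
  2 ^ suc m + 2 ^ suc m     ≡⟨ double (2 ^ suc m) ⟨
  2 ^ suc (suc m)           ∎
  where open ≤-Reasoning
Skew-weight twice = ≤-refl

Skew-total : ∀ {m ls b} → Skew m ls b → total ls ≤ treeSize m + treeSize m
Skew-total nil = z≤n
Skew-total (skip {m} s) = ≤-trans (Skew-total s)
  (+-mono-≤ (treeSize-mono m) (treeSize-mono m))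
Skew-total (once {m} s) = +-monoʳ-≤ (treeSize (suc m))
  (≤-trans (Skew-total s) (<⇒≤ (treeSize+treeSize< m)))
Skew-total (twice {m}) = ≤-reflexive (cong (treeSize (suc m) +_) (+-identityʳ _))

-- Minimality of skew binary numerals

lowBit : ℕ → ℕ
lowBit 0             = 0
lowBit 1             = 1
lowBit (suc (suc n)) = lowBit n

-- Only the `f` lowest binary digits are counted, which makes the recursion structural. Upper bounds
-- hold for every `f`; lower bounds need `f` large.
popcount : ℕ → ℕ → ℕ
popcount zero    x = 0
popcount (suc f) x = lowBit x + popcount f ⌊ x /2⌋

+-double-suc : ∀ x y → x + (suc y + suc y) ≡ suc (suc (x + (y + y)))
+-double-suc = solve-∀

lowBit-+-double : ∀ x y → lowBit (x + (y + y)) ≡ lowBit x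
lowBit-+-double x zero    = cong lowBit (+-identityʳ x)
lowBit-+-double x (suc y) = trans (cong lowBit (+-double-suc x y)) (lowBit-+-double x y)

half-+-double : ∀ x y → ⌊ x + (y + y) /2⌋ ≡ ⌊ x /2⌋ + y
half-+-double x zero    = trans (cong ⌊_/2⌋ (+-identityʳ x)) (sym (+-identityʳ _))
half-+-double x (suc y) = begin
  ⌊ x + (suc y + suc y) /2⌋       ≡⟨ cong ⌊_/2⌋ (+-double-suc x y) ⟩
  suc ⌊ x + (y + y) /2⌋           ≡⟨ cong suc (half-+-double x y) ⟩
  suc (⌊ x /2⌋ + y)               ≡⟨ +-suc ⌊ x /2⌋ y ⟨
  ⌊ x /2⌋ + suc y                 ∎
  where open ≡-Reasoning

popcount-+-double : ∀ f x y → popcount (suc f) (x + 2 * y) ≡ lowBit x + popcount f (⌊ x /2⌋ + y)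
popcount-+-double f x y = trans
  (cong (λ d → popcount (suc f) (x + d)) (double y))
  (cong₂ _+_ (lowBit-+-double x y) (cong (popcount f) (half-+-double x y)))

half-< : ∀ x y → x < y + y → ⌊ x /2⌋ < y
half-< x y x<2y = ≰⇒> λ y≤h → <⇒≱ x<2y (begin
  y + y                   ≤⟨ +-mono-≤ y≤h (≤-trans y≤h (⌊n/2⌋≤⌈n/2⌉ x)) ⟩
  ⌊ x /2⌋ + ⌈ x /2⌉       ≡⟨ ⌊n/2⌋+⌈n/2⌉≡n x ⟩
  x                       ∎)
  where open ≤-Reasoning

-- Either the lowest bit is set and nothing else changes, or it is cleared and the carry passes to
-- the half.
popcount-suc : ∀ f x → popcount f (suc x) ≤ suc (popcount f x)
popcount-suc zero    x = z≤n
popcount-suc (suc f) x = go x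
  where
  step : ∀ x → lowBit (suc x) ≡ 1 × lowBit x ≡ 0 × ⌊ suc x /2⌋ ≡ ⌊ x /2⌋
             ⊎ lowBit (suc x) ≡ 0 × lowBit x ≡ 1 × ⌊ suc x /2⌋ ≡ suc ⌊ x /2⌋
  step 0 = inj₁ (refl , refl , refl)
  step 1 = inj₂ (refl , refl , refl)
  step (suc (suc x)) with step x
  ... | inj₁ (p , q , r) = inj₁ (p , q , cong suc r)
  ... | inj₂ (p , q , r) = inj₂ (p , q , cong suc r)
  go : ∀ x → popcount (suc f) (suc x) ≤ suc (popcount (suc f) x)
  go x with step x
  ... | inj₁ (p , q , r) rewrite p | q | r = ≤-refl
  ... | inj₂ (p , q , r) rewrite p | q | r = m≤n⇒m≤1+n (popcount-suc f ⌊ x /2⌋)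

popcount-+ : ∀ f x d → popcount f (x + d) ≤ popcount f x + d
popcount-+ f x zero    = ≤-reflexive (trans (cong (popcount f) (+-identityʳ x)) (sym (+-identityʳ _)))
popcount-+ f x (suc d) = begin
  popcount f (x + suc d)     ≡⟨ cong (popcount f) (+-suc x d) ⟩
  popcount f (suc (x + d))   ≤⟨ popcount-suc f (x + d) ⟩
  suc (popcount f (x + d))   ≤⟨ s≤s (popcount-+ f x d) ⟩
  suc (popcount f x + d)     ≡⟨ +-suc (popcount f x) d ⟨
  popcount f x + suc d       ∎
  where open ≤-Reasoning

-- Bits below the added power are untouched; peeling them off reduces to adding 1.
popcount-+-2^ : ∀ f x k → popcount f (x + 2 ^ k) ≤ suc (popcount f x)
popcount-+-2^ zero    x k       = z≤n
popcount-+-2^ (suc f) x zero    = ≤-trans (popcount-+ (suc f) x 1) (≤-reflexive (+-comm _ 1))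
popcount-+-2^ (suc f) x (suc k) = begin
  popcount (suc f) (x + 2 ^ suc k)           ≡⟨ popcount-+-double f x (2 ^ k) ⟩
  lowBit x + popcount f (⌊ x /2⌋ + 2 ^ k)    ≤⟨ +-monoʳ-≤ (lowBit x) (popcount-+-2^ f ⌊ x /2⌋ k) ⟩
  lowBit x + suc (popcount f ⌊ x /2⌋)        ≡⟨ +-suc (lowBit x) _ ⟩
  suc (popcount (suc f) x)                   ∎
  where open ≤-Reasoning

popcount-0 : ∀ f → popcount f 0 ≡ 0
popcount-0 zero    = refl
popcount-0 (suc f) = popcount-0 f

popcount-weight : ∀ f ls → popcount f (weight ls) ≤ length ls
popcount-weight f []       = ≤-reflexive (popcount-0 f)
popcount-weight f (l ∷ ls) = begin
  popcount f (2 ^ suc l + weight ls) ≡⟨ cong (popcount f) (+-comm (2 ^ suc l) (weight ls)) ⟩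
  popcount f (weight ls + 2 ^ suc l) ≤⟨ popcount-+-2^ f (weight ls) (suc l) ⟩
  suc (popcount f (weight ls))       ≤⟨ s≤s (popcount-weight f ls) ⟩
  suc (length ls)                    ∎
  where open ≤-Reasoning

-- There is no carry, since bit `m` of `x` is free, and `m < f` keeps that bit among those counted.
popcount-top : ∀ {f} m {x} → m < f → x < 2 ^ m → popcount f (x + 2 ^ m) ≡ suc (popcount f x)
popcount-top {suc f} zero    {zero} _ _ = refl
popcount-top {suc f} zero    {suc x} _ (s≤s ())
popcount-top {suc f} (suc m) {x} (s≤s m<f) x<2^ = begin
  popcount (suc f) (x + 2 ^ suc m)         ≡⟨ popcount-+-double f x (2 ^ m) ⟩
  lowBit x + popcount f (⌊ x /2⌋ + 2 ^ m)  ≡⟨ cong (lowBit x +_) (popcount-top m m<f ⌊x/2⌋<2^) ⟩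
  lowBit x + suc (popcount f ⌊ x /2⌋)      ≡⟨ +-suc (lowBit x) _ ⟩
  suc (popcount (suc f) x)                 ∎
  where
  open ≡-Reasoning
  ⌊x/2⌋<2^ : ⌊ x /2⌋ < 2 ^ m
  ⌊x/2⌋<2^ = half-< x (2 ^ m) (subst (x <_) (double (2 ^ m)) x<2^)

treeSize-< : ∀ k → treeSize k < 2 ^ k
treeSize-< k = ≤-reflexive (suc-treeSize k)

treeSize-top : ∀ k → treeSize (suc k) ≡ treeSize k + 2 ^ k
treeSize-top k = begin
  treeSize (suc k)                ≡⟨ treeSize-suc k ⟩
  suc (treeSize k + treeSize k)   ≡⟨ +-suc (treeSize k) (treeSize k) ⟨
  treeSize k + suc (treeSize k)   ≡⟨ cong (treeSize k +_) (suc-treeSize k) ⟩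
  treeSize k + 2 ^ k              ∎
  where open ≡-Reasoning

-- In binary `treeSize k` is a run of `k` ones; the next tree size puts one more on top.
popcount-treeSize : ∀ {f} k → k < f →
  popcount f (treeSize (suc k)) ≡ suc (popcount f (treeSize k))
popcount-treeSize {f} k k<f = trans (cong (popcount f) (treeSize-top k))
  (popcount-top k k<f (treeSize-< k))

-- One less than the weight of a numeral still has many ones: its lowest
-- power 2^k, k ≥ 1, is replaced by 2^k - 1, and the others are kept.
popcount-Skew : ∀ {m l ls b f} → Skew m (l ∷ ls) b → m < f →
  suc (length ls) ≤ popcount f (total (l ∷ ls) + length ls)
popcount-Skew (skip s) m<f = popcount-Skew s (≤-trans (n≤1+n _) m<f)
popcount-Skew {f = f} (once {m} {[]} s) m<f = subst (1 ≤_)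
  (sym (trans (cong (popcount f) (trans (+-identityʳ _) (+-identityʳ _)))
              (popcount-treeSize m (≤-trans (n≤1+n _) m<f))))
  (s≤s z≤n)
popcount-Skew {f = f} (once {m} {l ∷ ls} s) m<f = begin
  suc (suc (length ls))                               ≤⟨ s≤s (popcount-Skew s (≤-trans (n≤1+n _) m<f)) ⟩
  suc (popcount f x)                                  ≡⟨ popcount-top (suc m) m<f x<2^ ⟨
  popcount f (x + 2 ^ suc m)                          ≡⟨ cong (λ q → popcount f (x + q)) (suc-treeSize (suc m)) ⟨
  popcount f (x + suc (treeSize (suc m)))
    ≡⟨ cong (popcount f) (rearrange (treeSize (suc m)) (total (l ∷ ls)) (length ls)) ⟩
  popcount f (total (m ∷ l ∷ ls) + suc (length ls))   ∎
  where
  open ≤-Reasoning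
  x = total (l ∷ ls) + length ls
  x<2^ : x < 2 ^ suc m
  x<2^ = begin
    suc (total (l ∷ ls) + length ls)   ≡⟨ +-suc (total (l ∷ ls)) (length ls) ⟨
    total (l ∷ ls) + suc (length ls)   ≡⟨ total+length (l ∷ ls) ⟩
    weight (l ∷ ls)                    ≤⟨ Skew-weight s ⟩
    2 ^ suc m                          ∎
  rearrange : ∀ a b c → b + c + suc a ≡ a + b + suc c
  rearrange = solve-∀
-- Here the weight less 1 is 2^(m+2) - 1, a run of m + 2 ones, of which two suffice.
popcount-Skew {f = suc f} (twice {m}) m<f = begin
  2                                                       ≤⟨ s≤s (s≤s z≤n) ⟩
  suc (suc (popcount (suc f) (treeSize m)))               ≡⟨ cong suc (popcount-treeSize m (≤-trans (n≤1+n _) m<f)) ⟨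
  suc (popcount (suc f) (treeSize (suc m)))               ≡⟨ popcount-treeSize (suc m) m<f ⟨
  popcount (suc f) (treeSize (suc (suc m)))
    ≡⟨ cong (popcount (suc f)) (trans (treeSize-suc (suc m)) (rearrange (treeSize (suc m)))) ⟩
  popcount (suc f) (total (m ∷ m ∷ []) + 1)               ∎
  where
  open ≤-Reasoning
  rearrange : ∀ a → suc (a + a) ≡ a + (a + 0) + 1
  rearrange = solve-∀

-- As n is a sum of k numbers 2^i - 1 only if n + k is a sum of k powers of 2,
-- a shorter ks would make n + (length ls - 1) a sum of length ls - 1 powers
-- of 2, where n is the common total; extra powers 2^0 make up the length.
Skew-minimal : ∀ {m ls b} → Skew m ls b → ∀ ks → total ks ≡ total ls → length ls ≤ length ks
Skew-minimal {ls = []} _ _ _ = z≤n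
Skew-minimal {m} {l ∷ ls} s ks eq = ≮⇒≥ λ k<w →
  let d , k+d≡ = m≤n⇒∃[o]m+o≡n (≤-pred k<w) in
  <-irrefl refl (begin-strict
    length ls                                               <⟨ popcount-Skew s ≤-refl ⟩
    popcount (suc m) (total (l ∷ ls) + length ls)           ≡⟨ cong (popcount (suc m)) (cong₂ _+_ eq k+d≡) ⟨
    popcount (suc m) (total ks + (length ks + d))           ≡⟨ cong (popcount (suc m)) (+-assoc (total ks) _ d) ⟨
    popcount (suc m) (total ks + length ks + d)             ≡⟨ cong (λ x → popcount (suc m) (x + d)) (total+length ks) ⟩
    popcount (suc m) (weight ks + d)                        ≤⟨ popcount-+ (suc m) (weight ks) d ⟩
    popcount (suc m) (weight ks) + d                        ≤⟨ +-monoˡ-≤ d (popcount-weight (suc m) ks) ⟩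
    length ks + d                                           ≡⟨ k+d≡ ⟩
    length ls                                               ∎)
  where open ≤-Reasoning

-- Finite sets

Unique⇒AllPairs : {A : Set} {R : Rel A 0ℓ} {xs : List A} → Unique xs →
  (∀ {x y} → x ∈ᴸ xs → y ∈ᴸ xs → x ≢ y → R x y) → AllPairs R xs
Unique⇒AllPairs []         r = []
Unique⇒AllPairs (x≢ ∷ xs!) r =
  All.tabulate (λ y∈xs → r (here refl) (there y∈xs) (All.lookup x≢ y∈xs)) ∷
  Unique⇒AllPairs xs! (λ x∈ y∈ → r (there x∈) (there y∈))

-- Duplicate-free lists with the same members are permutations of each other.
HasSize-unique : {A : Set} {Q : Pred A 0ℓ} {m n : ℕ} → HasSize Q m → HasSize Q n → m ≡ n
HasSize-unique (xs , xs! , refl , xs∈) (ys , ys! , refl , ys∈) =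
  ↭-length (∼bag⇒↭ (unique∧set⇒bag xs! ys! λ {x} →
    mk⇔ (from (ys∈ x) ∘ to (xs∈ x)) (from (xs∈ x) ∘ to (ys∈ x))))
  where open Equivalence

∈⇒≤max : {A : Set} (f : A → ℕ) {xs : List A} {x : A} → x ∈ᴸ xs → f x ≤ max 0 (map f xs)
∈⇒≤max f {xs} x∈xs = All.lookup (xs≤max 0 (map f xs)) (∈-map⁺ f x∈xs)

-- Complete subtrees

vertex-≡ : ∀ {u v} → level u ≡ level v → index u ≡ index v → u ≡ v
vertex-≡ refl refl = refl

_≟ⱽ_ : DecidableEquality Vertex
u ≟ⱽ v = map′ (λ (p , q) → vertex-≡ p q) (λ eq → cong level eq , cong index eq)
  (level u ≟ level v ×-dec index u ≟ index v)

open import Data.List.Membership.DecPropositional _≟ⱽ_ using (_∈?_)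

infix 4 _⊑_

-- The vertices `⊑ r` form the complete subtree rooted at `r`. Paths are built from the lower end,
-- so two upward paths from one vertex can be compared step by step.
data _⊑_ : Rel Vertex 0ℓ where
  stop : ∀ {x} → x ⊑ x
  rise : ∀ {x r} → parent x ⊑ r → x ⊑ r

⊑-trans : ∀ {x y z} → x ⊑ y → y ⊑ z → x ⊑ z
⊑-trans stop     q = q
⊑-trans (rise p) q = rise (⊑-trans p q)

⊑-level : ∀ {x r} → x ⊑ r → level x ≤ level r
⊑-level stop     = ≤-refl
⊑-level (rise p) = ≤-trans (n≤1+n _) (⊑-level p)

⊑-index : ∀ {x r} → x ⊑ r → index r ≤ index x
⊑-index stop         = ≤-refl
⊑-index {x} (rise p) = ≤-trans (⊑-index p) (⌊n/2⌋≤n (index x))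

⊑-comparable : ∀ {x r s} → x ⊑ r → x ⊑ s → r ⊑ s ⊎ s ⊑ r
⊑-comparable stop     q        = inj₁ q
⊑-comparable (rise p) stop     = inj₂ (rise p)
⊑-comparable (rise p) (rise q) = ⊑-comparable p q

⊑-sameLevel : ∀ {r s} → level r ≡ level s → r ⊑ s → r ≡ s
⊑-sameLevel eq stop     = refl
⊑-sameLevel eq (rise p) = contradiction (⊑-level p) (<⇒≱ (≤-reflexive (cong suc (sym eq))))

-- The children of index `j` have indices 2j and 2j + 1. The empty tree at level 0 lets the leaves,
-- at level 1, follow the general rule.
treeAt : ℕ → ℕ → List Vertex
treeAt zero    j = []
treeAt (suc l) j = ⟨ suc l , j ⟩ ∷ treeAt l (j + j) ++ treeAt l (suc (j + j))

tree : Vertex → List Vertex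
tree v = treeAt (level v) (index v)

length-treeAt : ∀ l j → length (treeAt l j) ≡ treeSize l
length-treeAt zero    j = refl
length-treeAt (suc l) j = begin
  suc (length (treeAt l (j + j) ++ treeAt l (suc (j + j))))
    ≡⟨ cong suc (length-++ (treeAt l (j + j))) ⟩
  suc (length (treeAt l (j + j)) + length (treeAt l (suc (j + j))))
    ≡⟨ cong suc (cong₂ _+_ (length-treeAt l _) (length-treeAt l _)) ⟩
  suc (treeSize l + treeSize l)
    ≡⟨ treeSize-suc l ⟨
  treeSize (suc l) ∎
  where open ≡-Reasoning

half-even : ∀ j → ⌊ j + j /2⌋ ≡ j
half-even j = sym (n≡⌊n+n/2⌋ j)

half-odd : ∀ j → ⌊ suc (j + j) /2⌋ ≡ j
half-odd j = half-+-double 1 j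

even⊎odd : ∀ j → j ≡ ⌊ j /2⌋ + ⌊ j /2⌋ ⊎ j ≡ suc (⌊ j /2⌋ + ⌊ j /2⌋)
even⊎odd 0 = inj₁ refl
even⊎odd 1 = inj₂ refl
even⊎odd (suc (suc j)) with even⊎odd j
... | inj₁ eq = inj₁ (trans (cong (2 +_) eq) (cong suc (sym (+-suc ⌊ j /2⌋ ⌊ j /2⌋))))
... | inj₂ eq = inj₂ (trans (cong (2 +_) eq) (cong (suc ∘ suc) (sym (+-suc ⌊ j /2⌋ ⌊ j /2⌋))))

child-⊑ : ∀ l {i j} → ⌊ i /2⌋ ≡ j → ⟨ suc l , i ⟩ ⊑ ⟨ suc (suc l) , j ⟩
child-⊑ l refl = rise stop

∈-treeAt⁻ : ∀ l j {x} → x ∈ᴸ treeAt (suc l) j → x ⊑ ⟨ suc l , j ⟩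
∈-treeAt⁻ l       j (here refl) = stop
∈-treeAt⁻ (suc l) j (there x∈) with ∈-++⁻ (treeAt (suc l) (j + j)) x∈
... | inj₁ x∈ˡ = ⊑-trans (∈-treeAt⁻ l (j + j) x∈ˡ) (child-⊑ l (half-even j))
... | inj₂ x∈ʳ = ⊑-trans (∈-treeAt⁻ l (suc (j + j)) x∈ʳ) (child-⊑ l (half-odd j))

∈-tree⁻ : ∀ {x} r → x ∈ᴸ tree r → x ⊑ r
∈-tree⁻ ⟨ suc l , j ⟩ x∈ = ∈-treeAt⁻ l j x∈

root∈tree : ∀ r → r ∈ᴸ tree r
root∈tree ⟨ suc l , j ⟩ = here refl

treeAt-child : ∀ l j x → parent x ∈ᴸ treeAt l j → x ∈ᴸ treeAt l j
treeAt-child (suc _) _ x (here refl) with even⊎odd (index x)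
... | inj₁ eq = there (∈-++⁺ˡ (subst (λ j → x ∈ᴸ treeAt (level x) j) eq (root∈tree x)))
... | inj₂ eq = there (∈-++⁺ʳ (treeAt (level x) _) (subst (λ j → x ∈ᴸ treeAt (level x) j) eq (root∈tree x)))
treeAt-child (suc l) j x (there px∈) with ∈-++⁻ (treeAt l (j + j)) px∈
... | inj₁ px∈ˡ = there (∈-++⁺ˡ (treeAt-child l _ x px∈ˡ))
... | inj₂ px∈ʳ = there (∈-++⁺ʳ (treeAt l (j + j)) (treeAt-child l _ x px∈ʳ))

∈-tree⁺ : ∀ {x r} → x ⊑ r → x ∈ᴸ tree r
∈-tree⁺ {x} stop         = root∈tree x
∈-tree⁺ {x} {r} (rise p) = treeAt-child (level r) (index r) x (∈-tree⁺ p)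

∈-treeAt-level : ∀ l j {x} → x ∈ᴸ treeAt l j → level x ≤ l
∈-treeAt-level (suc l) j x∈ = ⊑-level (∈-treeAt⁻ l j x∈)

treeAt-disjoint : ∀ l {i j} → i ≢ j → Disjoint (treeAt l i) (treeAt l j)
treeAt-disjoint (suc l) {i} {j} i≢j (x∈ᵢ , x∈ⱼ)
  with ⊑-comparable (∈-treeAt⁻ l i x∈ᵢ) (∈-treeAt⁻ l j x∈ⱼ)
... | inj₁ p = i≢j (cong index (⊑-sameLevel refl p))
... | inj₂ p = i≢j (cong index (sym (⊑-sameLevel refl p)))

treeAt-unique : ∀ l j → Unique (treeAt l j)
treeAt-unique zero    j = []
treeAt-unique (suc l) j =
  All.tabulate (λ x∈ eq → <⇒≱ (n<1+n l) (subst (_≤ l) (cong level (sym eq)) (below x∈))) ∷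
  Unique.++⁺ (treeAt-unique l _) (treeAt-unique l _) (treeAt-disjoint l (<⇒≢ (n<1+n (j + j))))
  where
  below : ∀ {x} → x ∈ᴸ treeAt l (j + j) ++ treeAt l (suc (j + j)) → level x ≤ l
  below x∈ with ∈-++⁻ (treeAt l (j + j)) x∈
  ... | inj₁ x∈ˡ = ∈-treeAt-level l _ x∈ˡ
  ... | inj₂ x∈ʳ = ∈-treeAt-level l _ x∈ʳ

-- Forests

-- Distinct roots have disjoint subtrees; equivalently, the roots form an antichain for `⊑`.
Separated : List Vertex → Set
Separated rs = ∀ {r s x} → r ∈ᴸ rs → s ∈ᴸ rs → x ⊑ r → x ⊑ s → r ≡ s

Covered : List Vertex → Pred Vertex 0ℓ
Covered rs x = Any (x ⊑_) rs

-- Levels are at least 1, so `pred` loses nothing; it matches the convention of `total`, where `l`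
-- stands for height l + 1.
heights : List Vertex → List ℕ
heights = map (pred ∘ level)

forest : List Vertex → List Vertex
forest = concatMap tree

length-forest : ∀ rs → length (forest rs) ≡ total (heights rs)
length-forest []       = refl
length-forest (r ∷ rs) = begin
  length (tree r ++ forest rs)
    ≡⟨ length-++ (tree r) ⟩
  length (tree r) + length (forest rs)
    ≡⟨ cong₂ _+_ (length-treeAt (level r) (index r)) (length-forest rs) ⟩
  treeSize (level r) + total (heights rs)
    ≡⟨ cong (λ l → treeSize l + total (heights rs)) (suc-pred (level r) {{level≢0 r}}) ⟨
  total (heights (r ∷ rs)) ∎
  where
  open ≡-Reasoning
  level≢0 : ∀ v → NonZero (level v)
  level≢0 ⟨ suc l , j ⟩ = _

∈-forest⁺ : ∀ {rs x} → Covered rs x → x ∈ᴸ forest rs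
∈-forest⁺ p = ∈-concatMap⁺ tree (Any.map ∈-tree⁺ p)

∈-forest⁻ : ∀ {rs x} → x ∈ᴸ forest rs → Covered rs x
∈-forest⁻ x∈ = Any.map (∈-tree⁻ _) (∈-concatMap⁻ tree x∈)

Covered-size : ∀ {rs} → Unique rs → Separated rs → HasSize (Covered rs) (total (heights rs))
Covered-size {rs} rs! sep = forest rs ,
  Unique.concat⁺
    (All.map⁺ (All.tabulate λ {r} _ → treeAt-unique (level r) (index r)))
    (AllPairs.map⁺ (Unique⇒AllPairs rs! λ r∈ s∈ r≢s (x∈r , x∈s) →
      r≢s (sep r∈ s∈ (∈-tree⁻ _ x∈r) (∈-tree⁻ _ x∈s)))) ,
  length-forest rs ,
  λ x → mk⇔ ∈-forest⁻ ∈-forest⁺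

-- Admissible sets

DownClosed : Pred Vertex 0ℓ → Set
DownClosed S = ∀ x → parent x ∈ S → x ∈ S

DownClosed-⊑ : ∀ S {x r} → DownClosed S → x ⊑ r → r ∈ S → x ∈ S
DownClosed-⊑ S down stop     r∈S = r∈S
DownClosed-⊑ S down (rise p) r∈S = down _ (DownClosed-⊑ S down p r∈S)

Covered-downClosed : ∀ rs → DownClosed (Covered rs)
Covered-downClosed rs x = Any.map rise

ascend : ℕ → Vertex → Vertex
ascend zero    x = x
ascend (suc t) x = ascend t (parent x)

level-ascend : ∀ t x → level (ascend t x) ≡ t + level x
level-ascend zero    x = refl
level-ascend (suc t) x = trans (level-ascend t (parent x)) (+-suc t (level x))

index-ascend : ∀ t x → index x ≤ t → index (ascend t x) ≡ 0
index-ascend zero    x i≤t = n≤0⇒n≡0 i≤t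
index-ascend (suc t) x i≤t = index-ascend t (parent x) (half≤ (index x) i≤t)
  where
  half≤ : ∀ i → i ≤ suc t → ⌊ i /2⌋ ≤ t
  half≤ zero    _   = z≤n
  half≤ (suc i) i≤t = ≤-pred (≤-trans (⌊n/2⌋<n i) i≤t)

-- Any two vertices have a common ancestor: far enough up the index is 0.
DownClosed⇒Connected-∁ : ∀ S → DownClosed S → Connected (∁ S)
DownClosed⇒Connected-∁ S down u v u∉S v∉S =
  subst (Star Link u) meet (climb tᵤ u u∉S) ◅◅ reverse Link-sym (climb tᵥ v v∉S)
  where
  Link : Rel Vertex 0ℓ
  Link x y = Adj x y × x ∈ ∁ S × y ∈ ∁ S
  Link-sym : ∀ {x y} → Link x y → Link y x
  Link-sym (adj , x∉S , y∉S) = swap adj , y∉S , x∉S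
  climb : ∀ t x → x ∈ ∁ S → Star Link x (ascend t x)
  climb zero    x x∉S = ε
  climb (suc t) x x∉S = (inj₁ refl , x∉S , x∉S ∘ down x) ◅ climb t (parent x) (x∉S ∘ down x)
  -- The indices make both ascents long enough to reach index 0; adding the level of the other
  -- vertex makes them end at the same level.
  tᵤ tᵥ : ℕ
  tᵤ = index u + index v + level v
  tᵥ = index u + index v + level u
  meet : ascend tᵤ u ≡ ascend tᵥ v
  meet = vertex-≡
    (begin
      level (ascend tᵤ u)                            ≡⟨ level-ascend tᵤ u ⟩
      index u + index v + level v + level u          ≡⟨ +-assoc (index u + index v) _ _ ⟩
      index u + index v + (level v + level u)        ≡⟨ cong (index u + index v +_) (+-comm (level v) _) ⟩
      index u + index v + (level u + level v)        ≡⟨ +-assoc (index u + index v) _ _ ⟨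
      index u + index v + level u + level v          ≡⟨ level-ascend tᵥ v ⟨
      level (ascend tᵥ v)                            ∎)
    (trans (index-ascend tᵤ u (≤-trans (m≤m+n _ _) (m≤m+n _ _)))
           (sym (index-ascend tᵥ v (≤-trans (m≤n+m (index v) (index u)) (m≤m+n _ _)))))
    where open ≡-Reasoning

-- A path from x ∉ S to a vertex above all of S stays below x if parent x ∈ S.
Connected-∁⇒DownClosed : ∀ {S n} → HasSize S n → Connected (∁ S) → DownClosed S
Connected-∁⇒DownClosed {S} (xs , _ , _ , xs∈) conn x px∈S =
  -- The list enumerating `S` decides membership, so a proof by contradiction is available.
  decidable-stable (map′ (to (xs∈ x)) (from (xs∈ x)) (x ∈? xs)) λ x∉S →
    <⇒≱ (s≤s (m≤m⊔n (level x) M)) (⊑-level (stay (conn x high x∉S high∉S) stop))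
  where
  open Equivalence
  M : ℕ
  M = max 0 (map level xs)
  high : Vertex
  high = ⟨ suc (level x ⊔ M) , 0 ⟩
  high∉S : high ∉ S
  high∉S high∈S = <⇒≱ (s≤s (m≤n⊔m (level x) M)) (∈⇒≤max level (from (xs∈ high) high∈S))
  stay : ∀ {y z} → Star (λ u v → Adj u v × u ∈ ∁ S × v ∈ ∁ S) y z → y ⊑ x → z ⊑ x
  stay ε p = p
  stay ((inj₁ refl , _ , py∉S) ◅ path) stop     = contradiction px∈S py∉S
  stay ((inj₁ refl , _ , _)    ◅ path) (rise p) = stay path p
  stay ((inj₂ refl , _ , _)    ◅ path) p        = stay path (rise p)

-- The cut consists of the edges from roots to their parents: children of covered vertices are
-- covered, and an upward edge leaves a subtree only at its root.
Covered-cut : ∀ {rs} → Unique rs → Separated rs → HasSize (Cut (Covered rs)) (length rs)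
Covered-cut {rs} rs! sep = map edge rs , Unique.map⁺ (cong proj₁) rs! , length-map edge rs ,
  λ (u , v) → mk⇔ sound (complete {u} {v})
  where
  edge : Vertex → Vertex × Vertex
  edge r = r , parent r
  sound : ∀ {u v} → (u , v) ∈ᴸ map edge rs → Cut (Covered rs) (u , v)
  sound e∈ with ∈-map⁻ edge e∈
  ... | r , r∈ , refl = inj₁ refl , lose r∈ stop , λ pr∈ →
    -- A root `s` above the parent of `r` would equal `r` by separation, putting the parent below
    -- `r`.
    case find pr∈ of λ (s , s∈ , p) → case sep r∈ s∈ stop (rise p) of λ where
      refl → <⇒≱ (n<1+n (level r)) (⊑-level p)
  complete : ∀ {u v} → Cut (Covered rs) (u , v) → (u , v) ∈ᴸ map edge rs
  complete (inj₂ refl , u∈ , v∉) = contradiction (Any.map rise u∈) v∉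
  complete (inj₁ refl , u∈ , v∉) with find u∈
  ... | r , r∈ , stop   = ∈-map⁺ edge r∈
  ... | r , r∈ , rise p = contradiction (lose r∈ p) v∉

-- Forests with prescribed heights

freshIndex : List Vertex → ℕ
freshIndex rs = suc (max 0 (map index (forest rs)))

-- Indices never increase on the way up, so every vertex below the new root has an index larger than
-- any in the old forest, whatever the level of the root.
freshIndex-⋢ : ∀ {rs l s x} → s ∈ᴸ rs → x ⊑ ⟨ suc l , freshIndex rs ⟩ → ¬ x ⊑ s
freshIndex-⋢ s∈ x⊑r x⊑s = <⇒≱ (⊑-index x⊑r) (∈⇒≤max index (∈-forest⁺ (lose s∈ x⊑s)))

roots : List ℕ → List Vertex
roots []       = []
roots (l ∷ ls) = ⟨ suc l , freshIndex (roots ls) ⟩ ∷ roots ls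

heights-roots : ∀ ls → heights (roots ls) ≡ ls
heights-roots []       = refl
heights-roots (l ∷ ls) = cong (l ∷_) (heights-roots ls)

roots-unique : ∀ ls → Unique (roots ls)
roots-unique []       = []
roots-unique (l ∷ ls) = All.tabulate (λ { s∈ refl → freshIndex-⋢ s∈ stop stop }) ∷ roots-unique ls

roots-separated : ∀ ls → Separated (roots ls)
roots-separated (l ∷ ls) (here refl) (here refl) _ _ = refl
roots-separated (l ∷ ls) (here refl) (there s∈)  p q = contradiction q (freshIndex-⋢ s∈ p)
roots-separated (l ∷ ls) (there r∈)  (here refl) p q = contradiction p (freshIndex-⋢ r∈ q)
roots-separated (l ∷ ls) (there r∈)  (there s∈)  p q = roots-separated ls r∈ s∈ p q

-- For the upper bound on the minimum cut: any sum of tree sizes is realised with one cut edge per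
-- summand.
forest-admissible : ∀ ls → ∃[ S ] (Admissible (total ls) S × HasSize (Cut S) (length ls))
forest-admissible ls = Covered (roots ls) ,
  (subst (HasSize (Covered (roots ls)) ∘ total) (heights-roots ls)
     (Covered-size (roots-unique ls) (roots-separated ls)) ,
   DownClosed⇒Connected-∁ (Covered (roots ls)) (Covered-downClosed (roots ls))) ,
  subst (HasSize (Cut (Covered (roots ls))))
    (trans (sym (length-map _ (roots ls))) (cong length (heights-roots ls)))
    (Covered-cut (roots-unique ls) (roots-separated ls))

-- Decomposition of admissible sets

top : ∀ {S n x} → HasSize S n → x ∈ S → ∃[ r ] (x ⊑ r × r ∈ S × parent r ∉ S)
top {S} {x = x} (xs , _ , _ , xs∈) x∈S = search M x x∈S (m≤m+n M (level x))
  where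
  open Equivalence
  M : ℕ
  M = max 0 (map level xs)
  -- `t` bounds the ascents left; at 0 the parent lies above level `M`, hence outside `S`.
  search : ∀ t x → x ∈ S → M ≤ t + level x → ∃[ r ] (x ⊑ r × r ∈ S × parent r ∉ S)
  search t x x∈S M≤ with parent x ∈? xs
  ... | no px∉ = x , stop , x∈S , px∉ ∘ from (xs∈ (parent x))
  search zero    x x∈S M≤ | yes px∈ = contradiction (∈⇒≤max level px∈) (<⇒≱ (s≤s M≤))
  search (suc t) x x∈S M≤ | yes px∈ =
    let r , p , r∈S , pr∉S =
          search t (parent x) (to (xs∈ (parent x)) px∈)
            (subst (M ≤_) (sym (+-suc t (level x))) M≤)
    in  r , rise p , r∈S , pr∉S

-- For the lower bound: the ends in `S` of the cut edges are the roots of disjoint complete subtrees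
-- that make up `S`, so counting `S` through them gives `n` as a sum of `k` tree sizes.
admissible-forest : ∀ {S n k} → Admissible n S → HasSize (Cut S) k →
  ∃[ ks ] (length ks ≡ k × total ks ≡ n)
admissible-forest {S} {n} (size , conn) (es , es! , refl , es∈) =
  heights rs , trans (length-map _ rs) (length-map proj₁ es) ,
  HasSize-unique (Covered-size rs! sep) (resize size)
  where
  open Equivalence
  down : DownClosed S
  down = Connected-∁⇒DownClosed size conn
  rs : List Vertex
  rs = map proj₁ es
  cut-parent : ∀ {u v} → Cut S (u , v) → v ≡ parent u
  cut-parent (inj₁ eq   , _   , _)   = eq
  cut-parent (inj₂ refl , u∈S , v∉S) = contradiction (down _ u∈S) v∉S
  rs! : Unique rs
  -- The other end of a cut edge is the parent, so no two cut edges share their end in `S`.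
  rs! = AllPairs.map⁺ (Unique⇒AllPairs es! λ { {u , v} {u′ , v′} e∈ e′∈ e≢e′ refl →
    e≢e′ (cong (u ,_) (trans (cut-parent (to (es∈ _) e∈)) (sym (cut-parent (to (es∈ _) e′∈))))) })
  root : ∀ {r} → r ∈ᴸ rs → r ∈ S × parent r ∉ S
  root r∈ with ∈-map⁻ proj₁ r∈
  ... | (r , v) , e∈ , refl with to (es∈ _) e∈
  ...   | cut@(_ , r∈S , v∉S) = r∈S , subst (_∉ S) (cut-parent cut) v∉S
  maximal : ∀ {r s} → r ∈ᴸ rs → s ∈ᴸ rs → r ⊑ s → r ≡ s
  maximal r∈ s∈ stop     = refl
  maximal r∈ s∈ (rise p) =
    contradiction (DownClosed-⊑ S down p (proj₁ (root s∈))) (proj₂ (root r∈))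
  sep : Separated rs
  sep r∈ s∈ p q with ⊑-comparable p q
  ... | inj₁ r⊑s = maximal r∈ s∈ r⊑s
  ... | inj₂ s⊑r = sym (maximal s∈ r∈ s⊑r)
  covered⇔ : ∀ x → x ∈ S ⇔ x ∈ Covered rs
  covered⇔ x = mk⇔
    (λ x∈S → let r , p , r∈S , pr∉S = top size x∈S
             in  lose (∈-map⁺ proj₁ (from (es∈ (r , parent r)) (inj₁ refl , r∈S , pr∉S))) p)
    (λ x∈ → let r , r∈ , p = find x∈ in DownClosed-⊑ S down p (proj₁ (root r∈)))
  resize : HasSize S n → HasSize (Covered rs) n
  resize (xs , xs! , eq , xs∈) = xs , xs! , eq ,
    λ x → mk⇔ (to (covered⇔ x) ∘ to (xs∈ x)) (from (xs∈ x) ∘ from (covered⇔ x))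

-- The generating function

open import Data.Integer.Base using (+_)

z^-diagonal : ∀ m → (z^ m) m ≡ 1ℤ
z^-diagonal m = cong (if_then 1ℤ else 0ℤ) (dec-true (m ≟ m) refl)

z^-off-diagonal : ∀ {m n} → m ≢ n → (z^ m) n ≡ 0ℤ
z^-off-diagonal {m} {n} m≢n = cong (if_then 1ℤ else 0ℤ) (dec-false (m ≟ n) m≢n)

-- Splitting off the first term of the convolution at `suc n` leaves that of the shifted series
-- `f ∘ suc` at `n`, on which the induction runs.
⊛-z^-< : ∀ f {m n} → n < m → (f ⊛ z^ m) n ≡ 0ℤ
⊛-z^-< f {m} {zero} n<m
  rewrite z^-off-diagonal (>⇒≢ n<m) | ℤ.*-zeroʳ (f 0) = refl
⊛-z^-< f {m} {suc n} n<m
  rewrite z^-off-diagonal (>⇒≢ n<m) | ℤ.*-zeroʳ (f 0) =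
  trans (ℤ.+-identityˡ _) (⊛-z^-< (f ∘ suc) (<-trans (n<1+n n) n<m))

⊛-z^-+ : ∀ f m n → (f ⊛ z^ m) (m + n) ≡ f n
⊛-z^-+ f zero zero = trans (ℤ.+-identityʳ _) (ℤ.*-identityʳ (f 0))
⊛-z^-+ f (suc m) zero rewrite +-identityʳ m | z^-diagonal (suc m) =
  trans (cong₂ ℤ._+_ (ℤ.*-identityʳ (f 0)) (⊛-z^-< (f ∘ suc) (n<1+n m))) (ℤ.+-identityʳ _)
⊛-z^-+ f m (suc n)
  rewrite +-suc m n | z^-off-diagonal (<⇒≢ (s≤s (m≤m+n m n))) | ℤ.*-zeroʳ (f 0) =
  trans (ℤ.+-identityˡ _) (⊛-z^-+ (f ∘ suc) m n)

⊛-distribˡ-⊕ : ∀ f g h → f ⊛ (g ⊕ h) ≈ f ⊛ g ⊕ f ⊛ h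
⊛-distribˡ-⊕ f g h n = trans
  (sum-cong-≗ {suc n} λ i → ℤ.*-distribˡ-+ (f (toℕ i)) (g (n ∸ toℕ i)) (h (n ∸ toℕ i)))
  (∑-distrib-+ {suc n} (λ i → f (toℕ i) ℤ.* g (n ∸ toℕ i)) (λ i → f (toℕ i) ℤ.* h (n ∸ toℕ i)))

-- Coefficients of the partial products

partialP : ℕ → Series
partialP = partialProduct factor

partialP-suc-< : ∀ m {n} → n < treeSize (suc m) → partialP (suc m) n ≡ partialP m n
partialP-suc-< m {n} n< = begin
  partialP (suc m) n
    ≡⟨ ⊛-distribˡ-⊕ (partialP m) 𝟙 (z^ treeSize (suc m)) n ⟩
  (partialP m ⊛ 𝟙) n ℤ.+ (partialP m ⊛ z^ treeSize (suc m)) n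
    ≡⟨ cong₂ ℤ._+_ (⊛-z^-+ (partialP m) 0 n) (⊛-z^-< (partialP m) n<) ⟩
  partialP m n ℤ.+ 0ℤ
    ≡⟨ ℤ.+-identityʳ _ ⟩
  partialP m n ∎
  where open ≡-Reasoning

partialP-suc-+ : ∀ m n →
  partialP (suc m) (treeSize (suc m) + n) ≡ partialP m (treeSize (suc m) + n) ℤ.+ partialP m n
partialP-suc-+ m n = trans (⊛-distribˡ-⊕ (partialP m) 𝟙 (z^ treeSize (suc m)) (treeSize (suc m) + n))
  (cong₂ ℤ._+_ (⊛-z^-+ (partialP m) 0 _) (⊛-z^-+ (partialP m) (treeSize (suc m)) n))

-- The degree is the sum of the exponents used so far, which stays below the next exponent because
-- tree sizes more than double.
partialP-degree : ∀ m {n} → treeSize (suc m) ≤ n → partialP m n ≡ 0ℤ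
partialP-degree zero    {n} 1≤n = z^-off-diagonal (<⇒≢ 1≤n)
partialP-degree (suc m) {n} p≤n
  with m≤n⇒∃[o]m+o≡n (≤-trans (treeSize-mono (suc m)) p≤n)
... | r , refl = trans (partialP-suc-+ m r)
  (cong₂ ℤ._+_ (partialP-degree m (m≤m+n _ r)) (partialP-degree m p≤r))
  where
  p≤r : treeSize (suc m) ≤ r
  p≤r = +-cancelˡ-≤ (treeSize (suc m)) _ _ (≤-trans (<⇒≤ (treeSize+treeSize< (suc m))) p≤n)

indicator : Bool → ℤ
indicator b = if b then 1ℤ else 0ℤ

Skew-< : ∀ {m ls b} → Skew m ls b → total ls < treeSize (suc m)
Skew-< {m} s = ≤-<-trans (Skew-total s) (treeSize+treeSize< m)

-- Follows the top digit. For 0 the last monomial is too large to be used. For 1 it must be used, as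
-- the total exceeds the degree of the earlier factors. For 2 even the remainder exceeds that
-- degree, and the coefficient is 0.
partialP-Skew : ∀ {m ls b} → Skew m ls b → partialP m (total ls) ≡ indicator b
partialP-Skew nil = refl
partialP-Skew (skip {m} s) = trans (partialP-suc-< m (Skew-< s)) (partialP-Skew s)
partialP-Skew (once {m} {ls} s) = trans (partialP-suc-+ m (total ls))
  (trans (cong₂ ℤ._+_ (partialP-degree m (m≤m+n _ _)) (partialP-Skew s)) (ℤ.+-identityˡ _))
partialP-Skew (twice {m}) = trans (partialP-suc-+ m _)
  (cong₂ ℤ._+_ (partialP-degree m (m≤m+n _ _)) (partialP-degree m (m≤m+n _ _)))

Skew-mono : ∀ {m m′ ls b} → m ≤′ m′ → Skew m ls b → Skew m′ ls b
Skew-mono ≤′-refl     s = s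
Skew-mono (≤′-step q) s = skip (Skew-mono q s)

-- Numerals of all numbers and the series identity

record Numeral (n : ℕ) : Set where
  constructor numeral
  field
    {bound}  : ℕ
    {levels} : List ℕ
    {simple} : Bool
    skew     : Skew bound levels simple
    total≡   : total levels ≡ n

open Numeral

successor : ∀ {n} (d : Numeral n) →
  ∃[ e ] Step (simple d) (length (levels d)) (length (levels {suc n} e))
successor (numeral s refl) with incrementUnbounded s
... | m′ , ls′ , b′ , s′ , eq , st = numeral s′ eq , st

numeralOf : ∀ n → Numeral n
numeralOf zero    = numeral nil refl
numeralOf (suc n) = proj₁ (successor (numeralOf n))

δ : ℕ → ℕ
δ n = length (levels (numeralOf n))

Π : Series
Π n = indicator (simple (numeralOf n))

-- Leading zeros extend the numeral of `n` to every larger bound, so the coefficient is constant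
-- from its bound on.
Π-infiniteProduct : IsInfiniteProduct factor Π
Π-infiniteProduct n with numeralOf n
... | numeral {m} s refl = m , λ m′ m≤m′ → partialP-Skew (Skew-mono (≤⇒≤′ m≤m′) s)

Step-difference : ∀ {b v w} → Step b v w → (+ 2) ℤ.* indicator b ℤ.- 1ℤ ℤ.+ + v ≡ + w
Step-difference grow   = refl
Step-difference shrink = refl

z⊛1/[1-z]-suc : ∀ n → (z ⊛ 1/[1-z]) (suc n) ≡ 1ℤ
z⊛1/[1-z]-suc n = cong (λ s → 0ℤ ℤ.+ (1ℤ ℤ.+ s)) (sum-replicate-zero n)

δ-differences : Series
δ-differences = (+ 2) • Π ⊖ 1/[1-z]

-- Multiplication by 1/(1-z) forms partial sums, and the differences telescope from `δ 0`, which is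
-- 0 because the numeral of 0 is empty.
δ-differences-sum : ∀ n → (1/[1-z] ⊛ δ-differences) n ≡ + δ (suc n)
δ-differences-sum zero    = refl
δ-differences-sum (suc n) = trans
  (cong₂ ℤ._+_ (ℤ.*-identityˡ (δ-differences (suc n))) (δ-differences-sum n))
  (Step-difference (proj₂ (successor (numeralOf (suc n)))))

δ-ogf : ogf δ ≈ z ⊛ 1/[1-z] ⊛ ((+ 2) • Π ⊖ 1/[1-z])
δ-ogf zero    = refl
δ-ogf (suc n) = sym (begin
  -- The constant coefficient of `z ⊛ 1/[1-z]` is 0, so the first term of the convolution drops out.
  (z ⊛ 1/[1-z] ⊛ δ-differences) (suc n)                     ≡⟨ ℤ.+-identityˡ _ ⟩
  (((z ⊛ 1/[1-z]) ∘ suc) ⊛ δ-differences) n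
    ≡⟨ sum-cong-≗ {suc n} (λ i → cong (ℤ._* δ-differences (n ∸ toℕ i)) (z⊛1/[1-z]-suc (toℕ i))) ⟩
  (1/[1-z] ⊛ δ-differences) n                               ≡⟨ δ-differences-sum n ⟩
  + δ (suc n)                                               ∎)
  where open ≡-Reasoning

-- The forest of the numeral attains the value, and any competing cut yields a list with the same
-- total, which `Skew-minimal` shows to be no shorter.
δ-isδP : ∀ n → IsδP n (δ n)
δ-isδP n with numeralOf n
... | numeral {levels = ls} s refl = forest-admissible ls ,
  λ S k adm cut → case admissible-forest adm cut of λ where
    (ks , refl , eq) → Skew-minimal s ks eq

theorem3p9 : ∃[ δP ] ∃[ P ]
    ((∀ n → 1 ≤ n → IsδP n (δP n))
    × IsInfiniteProduct factor P
    × ogf δP ≈ z ⊛ 1/[1-z] ⊛ ((+ 2) • P ⊖ 1/[1-z]))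
theorem3p9 = δ , Π , (λ n _ → δ-isδP n) , Π-infiniteProduct , δ-ogf
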